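{- Let $G$ be a finite simple graph and let $u,v$ be distinct vertices of $G$. Then the vertex-identification map $\phi_{u,v}:B(G)\to B(G/\{u,v\})$ is surjective and continuous with respect to the star topologies.
   Context: Graphs are finite and simple: $G=(V(G),E(G))$ with $E(G)$ a set of 2-element subsets of $V(G)$, and $uv$ denotes the edge $\{u,v\}$. The bare representation $B(G)$ is the disjoint union $V(G)\sqcup E(G)$. The open star of $v\in V(G)$ is $S_G(v)=\{v\}\cup\{e\in E(G): e \text{ is incident to } v\}\subseteq B(G)$. The star topology on $B(G)$ is the topology generated by the sub-basis $\{S_G(v):v\in V(G)\}$. Vertex-identification: for distinct vertices $u,v$ of $G$ (adjacent or not) and a new vertex $w$, the graph $G/\{u,v\}$ has vertex set $(V(G)\setminus\{u,v\})\cup\{w\}$ and edge set consisting of all edges of $G$ incident to neither $u$ nor $v$, together with all $wx$ with $x\in V(G)\setminus\{u,v\}$ and ($ux\in E(G)$ or $vx\in E(G)$). The vertex-identification map $\phi_{u,v}:B(G)\to B(G/\{u,v\})$ fixes every vertex other than $u,v$, sends $u$ and $v$ to $w$, fixes every edge incident to neither $u$ nor $v$, sends each edge $ux$ or $vx$ with $x\ne u,v$ to $wx$, and, if $uv\in E(G)$, sends the edge $uv$ to the vertex $w$. -}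

module Defs where

open import Data.Empty using (⊥; ⊥-elim-irr)
open import Data.List.Base using (List; map)
open import Data.List.Membership.Propositional using () renaming (_∈_ to _∈ₗ_)
open import Data.List.Membership.Propositional.Properties using (∈-map⁺)
open import Data.List.Relation.Unary.Enumerates.Setoid using (IsEnumeration)
open import Data.Product.Base using (_×_; _,_; proj₁; proj₂)
open import Data.Sum.Base using (_⊎_; inj₁; inj₂)
open import Data.Sum.Relation.Binary.Pointwise using (_⊎ₛ_; inj₁; inj₂)
open import Function.Bundles using (Func)
open import Level using (0ℓ; suc)
open import Relation.Binary.Bundles using (Setoid)
open import Relation.Binary.Core using (Rel)
open import Relation.Binary.Definitions
  using (DecidableEquality; Decidable; Symmetric; Irreflexive; _Respects_)
open import Relation.Binary.PropositionalEquality
  using (_≡_; refl; sym; trans; subst; setoid)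
open import Relation.Binary.Structures using (IsEquivalence)
open import Relation.Nullary using (Dec; yes; no; contradiction)
open import Relation.Nullary.Decidable using (_⊎-dec_)
open import Relation.Unary as Pred
  using (Pred; _∈_; _∉_; _∩_; _∪_; _≐_; _⊢_; ⋃; ｛_｝; U)

------------------------------------------------------------------------
-- Topologies

-- Points are compared by a setoid equality, so subsets of the space are
-- the predicates respecting it.  There is no separate clause for ∅: it
-- is the union of the empty family.

record Topology (X : Setoid 0ℓ 0ℓ) : Set (suc (suc 0ℓ)) where
  open Setoid X using (Carrier; _≈_)
  field
    Open      : Pred (Pred Carrier 0ℓ) (suc 0ℓ)
    open-U    : Open U
    open-∩    : ∀ {P Q} → Open P → Open Q → Open (P ∩ Q)
    open-⋃    : ∀ (J : Set) {P : J → Pred Carrier 0ℓ} →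
                (∀ j → Open (P j)) → Open (⋃ J P)
    open-≐    : ∀ {P Q} → P ≐ Q → Open P → Open Q
    respects  : ∀ {P} → Open P → P Respects _≈_

module _ {A I : Set} (S : I → Pred A 0ℓ) where

  data Generated : Pred (Pred A 0ℓ) (suc 0ℓ) where
    subbasic : ∀ i → Generated (S i)
    whole    : Generated U
    meet     : ∀ {P Q} → Generated P → Generated Q → Generated (P ∩ Q)
    join     : ∀ (J : Set) {P : J → Pred A 0ℓ} →
               (∀ j → Generated (P j)) → Generated (⋃ J P)
    resp-≐   : ∀ {P Q} → P ≐ Q → Generated P → Generated Q

module _ (X : Setoid 0ℓ 0ℓ) where
  open Setoid X using (Carrier; _≈_)

  generatedTopology : {I : Set} (S : I → Pred Carrier 0ℓ) →
                      (∀ i → S i Respects _≈_) → Topology X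
  generatedTopology S S-resp = record
    { Open     = Generated S
    ; open-U   = whole
    ; open-∩   = meet
    ; open-⋃   = join
    ; open-≐   = resp-≐
    ; respects = respects
    }
    where
    respects : ∀ {P} → Generated S P → P Respects _≈_
    respects (subbasic i)     x≈y p       = S-resp i x≈y p
    respects whole            x≈y p       = p
    respects (meet g h)       x≈y (p , q) = respects g x≈y p , respects h x≈y q
    respects (join J gs)      x≈y (j , p) = j , respects (gs j) x≈y p
    respects (resp-≐ (P⊆Q , Q⊆P) g) x≈y q = P⊆Q (respects g x≈y (Q⊆P q))

Continuous : {X Y : Setoid 0ℓ 0ℓ} → Topology X → Topology Y → Func X Y → Set (suc 0ℓ)
Continuous T T′ f = ∀ {P} → Topology.Open T′ P → Topology.Open T (Func.to f ⊢ P)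

------------------------------------------------------------------------
-- Finite simple graphs

-- A set of 2-element subsets of V is given as a symmetric irreflexive
-- relation.  Finiteness is constructive: V is enumerated by a list and
-- has decidable equality, and the edge set is a decidable subset.

record Graph : Set₁ where
  field
    V          : Set
    _≟_        : DecidableEquality V
    vertices   : List V
    enumerated : IsEnumeration (setoid V) vertices
    Adj        : Rel V 0ℓ
    adj?       : Decidable Adj
    adj-sym    : Symmetric Adj
    adj-irrefl : Irreflexive _≡_ Adj

-- An edge carries an ordering of its two endpoints, which ≈ᴱ forgets: E G
-- is the set of unordered pairs {x , y} with x and y adjacent.

record Edge (G : Graph) : Set where
  constructor edge
  open Graph G
  field
    end₁ end₂ : V
    adjacent  : Adj end₁ end₂

module _ (G : Graph) where
  open Graph G
  open Edge

  infix 4 _≈ᴱ_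

  _≈ᴱ_ : Rel (Edge G) 0ℓ
  e ≈ᴱ f = (end₁ e ≡ end₁ f × end₂ e ≡ end₂ f) ⊎ (end₁ e ≡ end₂ f × end₂ e ≡ end₁ f)

  ≈ᴱ-isEquivalence : IsEquivalence _≈ᴱ_
  ≈ᴱ-isEquivalence = record
    { refl  = inj₁ (refl , refl)
    ; sym   = λ where
        (inj₁ (p , q)) → inj₁ (sym p , sym q)
        (inj₂ (p , q)) → inj₂ (sym q , sym p)
    ; trans = λ where
        (inj₁ (p , q)) (inj₁ (r , s)) → inj₁ (trans p r , trans q s)
        (inj₁ (p , q)) (inj₂ (r , s)) → inj₂ (trans p r , trans q s)
        (inj₂ (p , q)) (inj₁ (r , s)) → inj₂ (trans p s , trans q r)
        (inj₂ (p , q)) (inj₂ (r , s)) → inj₁ (trans p s , trans q r)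
    }

  E : Setoid 0ℓ 0ℓ
  E = record { Carrier = Edge G ; _≈_ = _≈ᴱ_ ; isEquivalence = ≈ᴱ-isEquivalence }

  B : Setoid 0ℓ 0ℓ
  B = setoid V ⊎ₛ E

  Incident : Edge G → V → Set
  Incident e x = x ≡ end₁ e ⊎ x ≡ end₂ e

  openStar : V → Pred (Setoid.Carrier B) 0ℓ
  openStar x (inj₁ y) = y ≡ x
  openStar x (inj₂ e) = Incident e x

  openStar-respects : ∀ x → openStar x Respects Setoid._≈_ B
  openStar-respects x (inj₁ refl)                 p        = p
  openStar-respects x (inj₂ (inj₁ (refl , refl))) p        = p
  openStar-respects x (inj₂ (inj₂ (refl , refl))) (inj₁ p) = inj₂ p
  openStar-respects x (inj₂ (inj₂ (refl , refl))) (inj₂ p) = inj₁ p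

  starTopology : Topology B
  starTopology = generatedTopology B openStar openStar-respects

------------------------------------------------------------------------
-- Vertex-identification

module Identification (G : Graph) (u v : Graph.V G) where
  open Graph G

  Identified : Pred V 0ℓ
  Identified = ｛ u ｝ ∪ ｛ v ｝

  identified? : Pred.Decidable Identified
  identified? x = (u ≟ x) ⊎-dec (v ≟ x)

  -- The proof of x ∉ Identified is irrelevant, so each vertex of G other
  -- than u and v gives exactly one vertex old x.

  data V/ : Set where
    w   : V/
    old : (x : V) → .(x ∉ Identified) → V/

  _≟/_ : DecidableEquality V/
  w       ≟/ w       = yes refl
  w       ≟/ old y _ = no λ ()
  old x _ ≟/ w       = no λ ()
  old x _ ≟/ old y _ with x ≟ y
  ... | yes refl = yes refl
  ... | no  x≢y  = no λ { refl → x≢y refl }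

  Adj/ : Rel V/ 0ℓ
  Adj/ w         w         = ⊥
  Adj/ w         (old x _) = Adj u x ⊎ Adj v x
  Adj/ (old x _) w         = Adj u x ⊎ Adj v x
  Adj/ (old x _) (old y _) = Adj x y

  adj/? : Decidable Adj/
  adj/? w         w         = no λ ()
  adj/? w         (old x _) = adj? u x ⊎-dec adj? v x
  adj/? (old x _) w         = adj? u x ⊎-dec adj? v x
  adj/? (old x _) (old y _) = adj? x y

  adj/-sym : Symmetric Adj/
  adj/-sym {w}       {old y _} a = a
  adj/-sym {old x _} {w}       a = a
  adj/-sym {old x _} {old y _} a = adj-sym a

  adj/-irrefl : Irreflexive _≡_ Adj/
  adj/-irrefl {old x _} refl a = adj-irrefl refl a

  vertex′ : (x : V) → Dec (x ∈ Identified) → V/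
  vertex′ x (yes _) = w
  vertex′ x (no ¬p) = old x ¬p

  vertexMap : V → V/
  vertexMap x = vertex′ x (identified? x)

  vertex′-old : ∀ {x} .(¬p : x ∉ Identified) d → vertex′ x d ≡ old x ¬p
  vertex′-old ¬p (yes p) = ⊥-elim-irr (¬p p)
  vertex′-old ¬p (no _)  = refl

  vertex′-w : ∀ {x} → x ∈ Identified → ∀ d → vertex′ x d ≡ w
  vertex′-w p (yes _) = refl
  vertex′-w p (no ¬p) = contradiction p ¬p

  vertexMap-enumerates : IsEnumeration (setoid V/) (map vertexMap vertices)
  vertexMap-enumerates w =
    subst (_∈ₗ map vertexMap vertices) (vertex′-w (inj₁ refl) (identified? u))
          (∈-map⁺ vertexMap (enumerated u))
  vertexMap-enumerates (old x ¬p) =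
    subst (_∈ₗ map vertexMap vertices) (vertex′-old ¬p (identified? x))
          (∈-map⁺ vertexMap (enumerated x))

  quotient : Graph
  quotient = record
    { V          = V/
    ; _≟_        = _≟/_
    ; vertices   = map vertexMap vertices
    ; enumerated = vertexMap-enumerates
    ; Adj        = Adj/
    ; adj?       = adj/?
    ; adj-sym    = λ {x} {y} → adj/-sym {x} {y}
    ; adj-irrefl = adj/-irrefl
    }

  open Setoid (B quotient) using () renaming (Carrier to B/; _≈_ to _≈/_)

  adj-w : ∀ {x y} → x ∈ Identified → Adj x y → Adj u y ⊎ Adj v y
  adj-w (inj₁ refl) a = inj₁ a
  adj-w (inj₂ refl) a = inj₂ a

  -- As G has no loops, an edge with both endpoints in {u , v} is uv.

  edge′ : ∀ {x y} → Dec (x ∈ Identified) → Dec (y ∈ Identified) → Adj x y → B/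
  edge′         (yes _) (yes _) a = inj₁ w
  edge′ {y = y} (yes p) (no ¬q) a = inj₂ (edge w (old y ¬q) (adj-w p a))
  edge′ {x = x} (no ¬p) (yes q) a = inj₂ (edge (old x ¬p) w (adj-w q (adj-sym a)))
  edge′ {x} {y} (no ¬p) (no ¬q) a = inj₂ (edge (old x ¬p) (old y ¬q) a)

  φ₀ : Setoid.Carrier (B G) → B/
  φ₀ (inj₁ x)            = inj₁ (vertexMap x)
  φ₀ (inj₂ (edge x y a)) = edge′ (identified? x) (identified? y) a

  edge′-cong : ∀ {x y} (d : Dec (x ∈ Identified)) (e : Dec (y ∈ Identified)) a b →
               edge′ d e a ≈/ edge′ d e b
  edge′-cong (yes _) (yes _) a b = inj₁ refl
  edge′-cong (yes _) (no _)  a b = inj₂ (inj₁ (refl , refl))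
  edge′-cong (no _)  (yes _) a b = inj₂ (inj₁ (refl , refl))
  edge′-cong (no _)  (no _)  a b = inj₂ (inj₁ (refl , refl))

  edge′-swap : ∀ {x y} (d : Dec (x ∈ Identified)) (e : Dec (y ∈ Identified)) a b →
               edge′ d e a ≈/ edge′ e d b
  edge′-swap (yes _) (yes _) a b = inj₁ refl
  edge′-swap (yes _) (no _)  a b = inj₂ (inj₂ (refl , refl))
  edge′-swap (no _)  (yes _) a b = inj₂ (inj₂ (refl , refl))
  edge′-swap (no _)  (no _)  a b = inj₂ (inj₂ (refl , refl))

  φ₀-cong : ∀ {p q} → Setoid._≈_ (B G) p q → φ₀ p ≈/ φ₀ q
  φ₀-cong (inj₁ refl) = inj₁ refl
  φ₀-cong {inj₂ (edge x y a)} {inj₂ (edge _ _ b)} (inj₂ (inj₁ (refl , refl))) =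
    edge′-cong (identified? x) (identified? y) a b
  φ₀-cong {inj₂ (edge x y a)} {inj₂ (edge _ _ b)} (inj₂ (inj₂ (refl , refl))) =
    edge′-swap (identified? x) (identified? y) a b

  φ : Func (B G) (B quotient)
  φ = record { to = φ₀ ; cong = φ₀-cong }

infix 8 _/｛_,_｝

_/｛_,_｝ : (G : Graph) → Graph.V G → Graph.V G → Graph
G /｛ u , v ｝ = Identification.quotient G u v

φ : (G : Graph) (u v : Graph.V G) → Func (B G) (B (G /｛ u , v ｝))
φ = Identification.φ

{-# OPTIONS --safe #-}
module Submission where

open import Defs
open import Data.Product.Base using (_×_; _,_; ∃; ∃₂; proj₁)
open import Data.Sum.Base using (_⊎_; inj₁; inj₂)
open import Data.Sum.Relation.Binary.Pointwise using (inj₁; inj₂)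
open import Function.Bundles using (Func)
open import Function.Definitions using (Surjective)
open import Level using (0ℓ)
open import Relation.Binary.Bundles using (Setoid)
open import Relation.Binary.Definitions using (_Respects_)
open import Relation.Binary.PropositionalEquality using (_≡_; _≢_; refl; sym)
open import Relation.Nullary using (Dec; yes; no)
open import Relation.Unary using (Pred; _∈_; _⊢_; _⊆_; ⋃)

-- The preimage under φ of the open star of a vertex y of G/{u,v} is the
-- union of the open stars of the vertices of G lying over y.  The collapsed
-- edge uv fits this pattern: it lies in the stars of u and v, and is sent to
-- w.  For surjectivity, an edge pq of G/{u,v} comes from an edge xy of G with
-- x over p and y over q, and p ≠ q shows that xy is not collapsed.

-- Taking preimages commutes with finite intersections, arbitrary unions and `≐`, so induction on
-- how an open set is generated reduces continuity to the subbasic sets.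
generated-continuous :
  {X Y : Setoid 0ℓ 0ℓ} (T : Topology X) {I : Set} {S : I → Pred (Setoid.Carrier Y) 0ℓ}
  (S-resp : ∀ i → S i Respects Setoid._≈_ Y) (f : Func X Y) →
  (∀ i → Topology.Open T (Func.to f ⊢ S i)) →
  Continuous T (generatedTopology Y S S-resp) f
generated-continuous {X} {Y} T {S = S} S-resp f subbasic-open = preimage-open
  where
  open Topology T

  preimage-open : ∀ {P} → Generated S P → Open (Func.to f ⊢ P)
  preimage-open (subbasic i)           = subbasic-open i
  preimage-open whole                  = open-U
  preimage-open (meet g h)             = open-∩ (preimage-open g) (preimage-open h)
  preimage-open (join J gs)            = open-⋃ J (λ j → preimage-open (gs j))
  preimage-open (resp-≐ (P⊆Q , Q⊆P) g) =
    open-≐ ((λ p → P⊆Q p) , (λ q → Q⊆P q)) (preimage-open g)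

module _ (G : Graph) (u v : Graph.V G) where
  open Graph G
  open Identification G u v hiding (φ)

  Fibre : V/ → Set
  Fibre y = ∃ λ x → vertexMap x ≡ y

  vertexMap-w : ∀ {x} → x ∈ Identified → vertexMap x ≡ w
  vertexMap-w {x} p = vertex′-w p (identified? x)

  vertexMap-surjective : ∀ y → Fibre y
  vertexMap-surjective w          = u , vertexMap-w (inj₁ refl)
  vertexMap-surjective (old x ¬p) = x , vertex′-old ¬p (identified? x)

  -- At `w` the two summands of `Adj/` tell whether `u` or `v` serves as the endpoint over `w`. Both
  -- summands put `u` or `v` first, so `adj-sym` is applied when `w` comes second.
  adjacent-lift : ∀ p q → Adj/ p q →
                  ∃₂ λ x y → vertexMap x ≡ p × vertexMap y ≡ q × Adj x y
  adjacent-lift w (old y ¬q) (inj₁ a) =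
    u , y , vertexMap-w (inj₁ refl) , vertex′-old ¬q (identified? y) , a
  adjacent-lift w (old y ¬q) (inj₂ a) =
    v , y , vertexMap-w (inj₂ refl) , vertex′-old ¬q (identified? y) , a
  adjacent-lift (old x ¬p) w (inj₁ a) =
    x , u , vertex′-old ¬p (identified? x) , vertexMap-w (inj₁ refl) , adj-sym a
  adjacent-lift (old x ¬p) w (inj₂ a) =
    x , v , vertex′-old ¬p (identified? x) , vertexMap-w (inj₂ refl) , adj-sym a
  adjacent-lift (old x ¬p) (old y ¬q) a =
    x , y , vertex′-old ¬p (identified? x) , vertex′-old ¬q (identified? y) , a

  -- The decisions `d` and `e` are arbitrary, so that a case split on them reduces `edge′` and
  -- `vertex′` simultaneously.
  edge′-uncollapsed :
    ∀ {x y p q} (d : Dec (x ∈ Identified)) (e : Dec (y ∈ Identified)) (a : Adj x y) →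
    vertex′ x d ≡ p → vertex′ y e ≡ q → (b : Adj/ p q) →
    Setoid._≈_ (B quotient) (edge′ d e a) (inj₂ (edge p q b))
  -- Here `p` and `q` are both `w`, and `Adj/ w w` is empty.
  edge′-uncollapsed (yes _) (yes _) a refl refl ()
  edge′-uncollapsed (yes _) (no _)  a refl refl b = inj₂ (inj₁ (refl , refl))
  edge′-uncollapsed (no _)  (yes _) a refl refl b = inj₂ (inj₁ (refl , refl))
  edge′-uncollapsed (no _)  (no _)  a refl refl b = inj₂ (inj₁ (refl , refl))

  φ-preimage : ∀ y → ∃ λ x → Setoid._≈_ (B quotient) (φ₀ x) y
  φ-preimage (inj₁ y) with vertexMap-surjective y
  ... | x , fx≡y = inj₁ x , inj₁ fx≡y
  φ-preimage (inj₂ (edge p q b)) with adjacent-lift p q b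
  ... | x , y , fx≡p , fy≡q , a =
    inj₂ (edge x y a) , edge′-uncollapsed (identified? x) (identified? y) a fx≡p fy≡q b

  φ-surjective : Surjective (Setoid._≈_ (B G)) (Setoid._≈_ (B quotient)) φ₀
  φ-surjective y with φ-preimage y
  -- `Surjective` asks that every point equal to `x` in the setoid be sent to `y`; congruence of
  -- `φ₀` extends the property from `x` to these.
  ... | x , φx≈y = x , λ z≈x → Setoid.trans (B quotient) (φ₀-cong z≈x) φx≈y

  openStar-edge′⁻ :
    ∀ {x y z} (d : Dec (x ∈ Identified)) (e : Dec (y ∈ Identified)) (a : Adj x y) →
    openStar quotient z (edge′ d e a) → vertex′ x d ≡ z ⊎ vertex′ y e ≡ z
  -- The image is the vertex `w`, whose membership in a star is an equation. Both endpoints lie over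
  -- `z`, so either summand would do.
  openStar-edge′⁻ (yes _) (yes _) a w≡z        = inj₁ w≡z
  openStar-edge′⁻ (yes _) (no _)  a (inj₁ z≡p) = inj₁ (sym z≡p)
  openStar-edge′⁻ (yes _) (no _)  a (inj₂ z≡q) = inj₂ (sym z≡q)
  openStar-edge′⁻ (no _)  (yes _) a (inj₁ z≡p) = inj₁ (sym z≡p)
  openStar-edge′⁻ (no _)  (yes _) a (inj₂ z≡q) = inj₂ (sym z≡q)
  openStar-edge′⁻ (no _)  (no _)  a (inj₁ z≡p) = inj₁ (sym z≡p)
  openStar-edge′⁻ (no _)  (no _)  a (inj₂ z≡q) = inj₂ (sym z≡q)

  openStar-edge′⁺ :
    ∀ {x y z} (d : Dec (x ∈ Identified)) (e : Dec (y ∈ Identified)) (a : Adj x y) →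
    vertex′ x d ≡ z ⊎ vertex′ y e ≡ z → openStar quotient z (edge′ d e a)
  openStar-edge′⁺ (yes _) (yes _) a (inj₁ w≡z) = w≡z
  openStar-edge′⁺ (yes _) (yes _) a (inj₂ w≡z) = w≡z
  openStar-edge′⁺ (yes _) (no _)  a (inj₁ p≡z) = inj₁ (sym p≡z)
  openStar-edge′⁺ (yes _) (no _)  a (inj₂ q≡z) = inj₂ (sym q≡z)
  openStar-edge′⁺ (no _)  (yes _) a (inj₁ p≡z) = inj₁ (sym p≡z)
  openStar-edge′⁺ (no _)  (yes _) a (inj₂ q≡z) = inj₂ (sym q≡z)
  openStar-edge′⁺ (no _)  (no _)  a (inj₁ p≡z) = inj₁ (sym p≡z)
  openStar-edge′⁺ (no _)  (no _)  a (inj₂ q≡z) = inj₂ (sym q≡z)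

  -- Indexing by the fibre treats both kinds of vertex at once: over `w` the union is that of the
  -- stars of `u` and `v`, over `old x` it is the star of `x` alone.
  fibreStars : V/ → Pred (Setoid.Carrier (B G)) 0ℓ
  fibreStars z = ⋃ (Fibre z) (λ x → openStar G (proj₁ x))

  fibreStars⊆preimage : ∀ z → fibreStars z ⊆ φ₀ ⊢ openStar quotient z
  fibreStars⊆preimage z {inj₁ _} ((x , fx≡z) , refl) = fx≡z
  -- Matching `refl` makes the centre of the star an endpoint of the edge, so the fibre equation
  -- says that this endpoint lies over `z`.
  fibreStars⊆preimage z {inj₂ (edge x y a)} ((_ , fx≡z) , inj₁ refl) =
    openStar-edge′⁺ (identified? x) (identified? y) a (inj₁ fx≡z)
  fibreStars⊆preimage z {inj₂ (edge x y a)} ((_ , fy≡z) , inj₂ refl) =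
    openStar-edge′⁺ (identified? x) (identified? y) a (inj₂ fy≡z)

  preimage⊆fibreStars : ∀ z → φ₀ ⊢ openStar quotient z ⊆ fibreStars z
  preimage⊆fibreStars z {inj₁ x} fx≡z = (x , fx≡z) , refl
  preimage⊆fibreStars z {inj₂ (edge x y a)} s
    with openStar-edge′⁻ (identified? x) (identified? y) a s
  ... | inj₁ fx≡z = (x , fx≡z) , inj₁ refl
  ... | inj₂ fy≡z = (y , fy≡z) , inj₂ refl

  preimage-openStar : ∀ z → Topology.Open (starTopology G) (φ₀ ⊢ openStar quotient z)
  preimage-openStar z =
    resp-≐ ((λ {p} → fibreStars⊆preimage z {p}) , (λ {p} → preimage⊆fibreStars z {p}))
           (join (Fibre z) (λ x → subbasic (proj₁ x)))

theorem4p7 : (G : Graph) (u v : Graph.V G) → u ≢ v →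
    Surjective (Setoid._≈_ (B G)) (Setoid._≈_ (B (G /｛ u , v ｝))) (Func.to (φ G u v))
    × Continuous (starTopology G) (starTopology (G /｛ u , v ｝)) (φ G u v)
theorem4p7 G u v _ =
  φ-surjective G u v ,
  generated-continuous (starTopology G) (openStar-respects (G /｛ u , v ｝)) (φ G u v)
    (preimage-openStar G u v)
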